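{- Let $t \ge 3$ and $\Delta \ge 1$ be integers, and let $G$ be a simple graph on $n$ vertices with maximum degree at most $\Delta$. Write $n = a(\Delta+1)+b$ with $a, b \in \mathbb{Z}$ and $0 \le b \le \Delta$. Then $k_t(G) \le a\binom{\Delta+1}{t}+\binom{b}{t}$.
   Context: For a simple graph $G$ and an integer $t \ge 3$, $k_t(G)$ denotes the number of cliques of size $t$ in $G$ (i.e., the number of $t$-element vertex subsets that are pairwise adjacent). Binomial coefficients $\binom{m}{t}$ are $0$ when $0 \le m < t$. -}

module Defs where

open import Data.Bool using (Bool; true; false; _∧_; _∨_; not; if_then_else_)
open import Data.Fin using (_≟_)
open import Relation.Nullary.Decidable using (⌊_⌋)
open import Data.Nat using (_≡ᵇ_)
open import Data.Nat using (ℕ; zero; suc; _+_)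
open import Data.Fin using (Fin)
open import Data.List using (List; []; _∷_; map; _++_; length; filterᵇ)
open import Data.Vec using (Vec; []; _∷_; lookup)
open import Data.Fin.Subset using (Subset; ∣_∣)
open import Data.Product using (_×_)
open import Data.Vec using (allFin; foldr)
open import Relation.Binary.PropositionalEquality using (_≡_)

record SimpleGraph (n : ℕ) : Set where
  field
    adj       : Fin n → Fin n → Bool
    symmetric : ∀ i j → adj i j ≡ adj j i
    loopless  : ∀ i → adj i i ≡ false

open SimpleGraph public

countFin : ∀ {n} → (Fin n → Bool) → ℕ
countFin {n} p = foldr (λ _ → ℕ) (λ i acc → (if p i then 1 else 0) + acc) 0 (allFin n)

degree : ∀ {n} → SimpleGraph n → Fin n → ℕ
degree G v = countFin (λ w → adj G v w)

allSubsets : ∀ n → List (Subset n)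
allSubsets zero    = [] ∷ []
allSubsets (suc n) = map (true ∷_) (allSubsets n) ++ map (false ∷_) (allSubsets n)

allPairs : ∀ {n} → (Fin n → Fin n → Bool) → Bool
allPairs {n} p = foldr (λ _ → Bool) (λ i acc → foldr (λ _ → Bool) (λ j acc' → p i j ∧ acc') true (allFin n) ∧ acc) true (allFin n)

isClique : ∀ {n} → SimpleGraph n → Subset n → Bool
isClique {n} G S =
  allPairs (λ i j → not (lookup S i ∧ lookup S j) ∨ (⌊ i ≟ j ⌋ ∨ adj G i j))

k : ∀ {n} → ℕ → SimpleGraph n → ℕ
k t G = length (filterᵇ (λ S → (∣ S ∣ ≡ᵇ t) ∧ isClique G S) (allSubsets _))

{-# OPTIONS --safe #-}
module Submission where

-- The key inequality, for a vertex set U and t ≥ 3, is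
--   Σ_{v ∈ U} #{t-cliques S ⊆ U meeting N[v]}  ≤  Σ_{v ∈ U} #{t-sets S ⊆ U ∩ N[v]}.
-- For v ∈ S, a clique S is contained in N[v].  For v ∉ S, fix H = S ∪ {v}: the vertices v such that
-- H ∖ {v} is a clique with a neighbour of v are no more numerous than those dominating H.  Indeed, if
-- such an x has a non-neighbour y in H, then x and y are the only candidates; every neighbour of x in
-- H dominates H, and when y is a candidate too, the |H| - 2 ≥ 2 vertices other than x and y all do.
-- By averaging, some v ∈ U satisfies #{t-cliques meeting N[v]} ≤ |U ∩ N[v]| C t.  Deleting N[v] and
-- inducting on |U|, the bound follows from the convexity of m ↦ m C t.

open import Defs
open import Data.Bool using (Bool; true; false; T; not; _∧_; if_then_else_)
open import Data.Bool.Properties using (T-∧)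
open import Data.Fin using (Fin; zero; suc; _≟_)
open import Data.Fin.Properties using (any?; all?)
open import Data.Fin.Subset using (Subset; ∣_∣; _∈_; _∉_; _⊆_; _∩_; _─_; ⊤; Nonempty)
open import Data.Fin.Subset.Properties using (_∈?_; Empty-unique; ∣⊥∣≡0; ∣p∩q∣≤∣q∣; p∩q≢∅⇒∣p─q∣<∣p∣; _⊆?_; nonempty?; ∈⊤; ∣⊤∣≡n; p⊆q⇒∣p∣≤∣q∣; drop-∷-⊆; x∈p∩q⁺; x∈p∧x∉q⇒x∈p─q)
open import Data.List using (List; []; _∷_; map; _++_; length; filterᵇ; allFin; tabulate)
open import Data.List.Membership.Propositional using () renaming (_∈_ to _∈ˡ_)
open import Data.List.Membership.Propositional.Properties using (∈-allFin)
open import Data.List.Relation.Unary.Any using (here; there)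
open import Data.Nat using (ℕ; zero; suc; _+_; _*_; _∸_; _≤_; _<_; z≤n; s≤s; _≡ᵇ_; _≤?_)
import Data.Nat as ℕ
open import Data.Nat.Combinatorics using (_C_; nCk+nC[k+1]≡[n+1]C[k+1]; k>n⇒nCk≡0)
open import Data.Nat.Induction using (<-rec)
open import Data.Nat.Properties hiding (_≟_; _≤?_)
open import Data.Nat.Tactic.RingSolver using (solve-∀)
open import Data.Product using (∃; _×_; _,_; proj₁; proj₂)
open import Data.Sum using (_⊎_; inj₁; inj₂)
open import Data.Vec as Vec using ([]; _∷_; updateAt; here; there)
open import Data.Vec.Properties using (lookup∘tabulate; lookup∘updateAt′; lookup⇒[]=; []=⇒lookup; updateAt-minimal)
open import Function using (_∘_; id; const; case_of_)
open import Function.Bundles using (Equivalence)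
open import Relation.Binary.PropositionalEquality using (_≡_; _≢_; refl; sym; trans; cong; cong₂; subst)
open import Relation.Nullary using (Dec; yes; no; does; ¬_; contradiction)
open import Relation.Nullary.Decidable using (T?; _×-dec_; _→-dec_; _⊎-dec_; ¬?; dec-true; decidable-stable)
open import Relation.Unary using (Decidable)

variable
  n : ℕ
  A B : Set

-- Finite sums over lists.

∑ : List A → (A → ℕ) → ℕ
∑ []       f = 0
∑ (x ∷ xs) f = f x + ∑ xs f

∑-mono : ∀ (xs : List A) {f g} → (∀ x → f x ≤ g x) → ∑ xs f ≤ ∑ xs g
∑-mono []       f≤g = z≤n
∑-mono (x ∷ xs) f≤g = +-mono-≤ (f≤g x) (∑-mono xs f≤g)

∑-cong : ∀ (xs : List A) {f g} → (∀ x → f x ≡ g x) → ∑ xs f ≡ ∑ xs g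
∑-cong []       f≡g = refl
∑-cong (x ∷ xs) f≡g = cong₂ _+_ (f≡g x) (∑-cong xs f≡g)

+-interchange : ∀ a b c d → (a + b) + (c + d) ≡ (a + c) + (b + d)
+-interchange = solve-∀

∑-+ : ∀ (xs : List A) (f g : A → ℕ) → ∑ xs (λ x → f x + g x) ≡ ∑ xs f + ∑ xs g
∑-+ []       f g = refl
∑-+ (x ∷ xs) f g = trans (cong (f x + g x +_) (∑-+ xs f g)) (+-interchange (f x) (g x) _ _)

∑-0 : ∀ (xs : List A) → ∑ xs (const 0) ≡ 0
∑-0 []       = refl
∑-0 (x ∷ xs) = ∑-0 xs

∑-comm : ∀ (xs : List A) (ys : List B) (f : A → B → ℕ) →
         ∑ xs (λ x → ∑ ys (f x)) ≡ ∑ ys (λ y → ∑ xs (λ x → f x y))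
∑-comm []       ys f = sym (∑-0 ys)
∑-comm (x ∷ xs) ys f = trans (cong (∑ ys (f x) +_) (∑-comm xs ys f)) (sym (∑-+ ys _ _))

∑-++ : ∀ (xs ys : List A) f → ∑ (xs ++ ys) f ≡ ∑ xs f + ∑ ys f
∑-++ []       ys f = refl
∑-++ (x ∷ xs) ys f = trans (cong (f x +_) (∑-++ xs ys f)) (sym (+-assoc (f x) _ _))

∑-map : ∀ (g : A → B) xs f → ∑ (map g xs) f ≡ ∑ xs (f ∘ g)
∑-map g []       f = refl
∑-map g (x ∷ xs) f = cong (f (g x) +_) (∑-map g xs f)

∑-tabulate : ∀ (g : Fin n → A) f → ∑ (tabulate g) f ≡ ∑ (allFin n) (f ∘ g)
∑-tabulate {n = zero}  g f = refl
∑-tabulate {n = suc n} g f =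
  cong (f (g zero) +_) (trans (∑-tabulate (g ∘ suc) f) (sym (∑-tabulate suc (f ∘ g))))

-- This is the averaging principle in contrapositive form, later used to find a vertex where a
-- summed inequality also holds termwise.
∑-strict : ∀ {xs : List A} {f g x} → (∀ y → f y ≤ g y) → x ∈ˡ xs → f x < g x → ∑ xs f < ∑ xs g
∑-strict {xs = _ ∷ xs} f≤g (here refl) fx<gx = +-mono-<-≤ fx<gx (∑-mono xs f≤g)
∑-strict {xs = y ∷ xs} f≤g (there x∈)  fx<gx = +-mono-≤-< (f≤g y) (∑-strict f≤g x∈ fx<gx)

∑-allFin : ∀ n f → ∑ (allFin (suc n)) f ≡ f zero + ∑ (allFin n) (f ∘ suc)
∑-allFin n f = cong (f zero +_) (∑-tabulate suc f)

-- Indicators and counting.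

𝟙 : {P : Set} → Dec P → ℕ
𝟙 P? = if does P? then 1 else 0

𝟙-mono : {P Q : Set} (P? : Dec P) (Q? : Dec Q) → (P → Q) → 𝟙 P? ≤ 𝟙 Q?
𝟙-mono (no _)  Q?      P⇒Q = z≤n
𝟙-mono (yes _) (yes _) P⇒Q = ≤-refl
𝟙-mono (yes p) (no ¬q) P⇒Q = contradiction (P⇒Q p) ¬q

𝟙-∪ : {P Q R : Set} (P? : Dec P) (Q? : Dec Q) (R? : Dec R) → (R → P ⊎ Q) → 𝟙 R? ≤ 𝟙 P? + 𝟙 Q?
𝟙-∪ P?      Q? (no _)  f = z≤n
𝟙-∪ (yes _) Q? (yes _) f = s≤s z≤n
𝟙-∪ (no ¬p) Q? (yes r) f with f r
... | inj₁ p = contradiction p ¬p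
... | inj₂ q = 𝟙-mono (yes q) Q? id

𝟙-disjoint : {P Q R : Set} (P? : Dec P) (Q? : Dec Q) (R? : Dec R) →
             (P → R) → (Q → R) → (P → ¬ Q) → 𝟙 P? + 𝟙 Q? ≤ 𝟙 R?
𝟙-disjoint (yes p) (yes q) R? f g P⇒¬Q = contradiction q (P⇒¬Q p)
𝟙-disjoint (yes p) (no _)  R? f g P⇒¬Q = 𝟙-mono (yes p) R? f
𝟙-disjoint (no _)  Q?      R? f g P⇒¬Q = 𝟙-mono Q? R? g

𝟙-no : {P : Set} (P? : Dec P) → ¬ P → 𝟙 P? ≡ 0
𝟙-no (yes p) ¬p = contradiction p ¬p
𝟙-no (no _)  ¬p = refl

# : {P : A → Set} → List A → Decidable P → ℕ
# xs P? = ∑ xs (λ x → 𝟙 (P? x))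

#-singleton : ∀ (x : Fin n) → # (allFin n) (_≟ x) ≡ 1
#-singleton {suc n} zero    = trans (∑-allFin n (λ i → 𝟙 (i ≟ zero))) (cong suc (∑-0 (allFin n)))
#-singleton {suc n} (suc x) = trans (∑-allFin n (λ i → 𝟙 (i ≟ suc x))) (#-singleton x)

∣∣≡# : ∀ (S : Subset n) → ∣ S ∣ ≡ # (allFin n) (_∈? S)
∣∣≡# []          = refl
∣∣≡# (true ∷ S)  = trans (cong suc (∣∣≡# S)) (sym (∑-allFin _ (λ i → 𝟙 (i ∈? (true ∷ S)))))
∣∣≡# (false ∷ S) = trans (∣∣≡# S) (sym (∑-allFin _ (λ i → 𝟙 (i ∈? (false ∷ S)))))

-- Sums over the power set and flipping one element.

∑-allSubsets : ∀ n f → ∑ (allSubsets (suc n)) f ≡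
  ∑ (allSubsets n) (f ∘ (true ∷_)) + ∑ (allSubsets n) (f ∘ (false ∷_))
∑-allSubsets n f = trans (∑-++ (map (true ∷_) (allSubsets n)) _ f)
  (cong₂ _+_ (∑-map _ (allSubsets n) f) (∑-map _ (allSubsets n) f))

-- A single involution serves both as `S ∪ {v}` when `v ∉ S` and as `H ∖ {v}` when `v ∈ H`.
toggle : Fin n → Subset n → Subset n
toggle v S = updateAt S v not

-- Flipping permutes the power set: at the head it exchanges the two halves of the sum, further on
-- it acts inside each half.
∑-toggle : ∀ (v : Fin n) f → ∑ (allSubsets n) (f ∘ toggle v) ≡ ∑ (allSubsets n) f
∑-toggle {suc n} zero f = trans (∑-allSubsets n (f ∘ toggle zero))
  (trans (+-comm (∑ (allSubsets n) (f ∘ (false ∷_))) _) (sym (∑-allSubsets n f)))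
∑-toggle {suc n} (suc v) f = trans (∑-allSubsets n (f ∘ toggle (suc v)))
  (trans (cong₂ _+_ (∑-toggle v (f ∘ (true ∷_))) (∑-toggle v (f ∘ (false ∷_))))
         (sym (∑-allSubsets n f)))

-- For each `v` substitute `S = toggle v H`, then exchange the sums. Pairs `(v , S)` with `v ∉ S`
-- are thereby grouped by `H = S ∪ {v}`.
∑-by-toggle : ∀ (f : Fin n → Subset n → ℕ) →
  ∑ (allFin n) (λ v → ∑ (allSubsets n) (f v)) ≡ ∑ (allSubsets n) (λ H → ∑ (allFin n) (λ v → f v (toggle v H)))
∑-by-toggle {n} f = trans (∑-cong (allFin n) (λ v → sym (∑-toggle v (f v))))
                          (∑-comm (allFin n) (allSubsets n) (λ v H → f v (toggle v H)))

module _ {v : Fin n} {S : Subset n} where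

  ∈-toggle⁺ : ∀ {w} → w ≢ v → w ∈ S → w ∈ toggle v S
  ∈-toggle⁺ w≢v = updateAt-minimal _ v S w≢v

  ∈-toggle⁻ : ∀ {w} → w ≢ v → w ∈ toggle v S → w ∈ S
  ∈-toggle⁻ w≢v w∈ = lookup⇒[]= _ S (trans (sym (lookup∘updateAt′ _ v w≢v S)) ([]=⇒lookup w∈))

∈⇒∉-toggle : ∀ (v : Fin n) S → v ∈ S → v ∉ toggle v S
∈⇒∉-toggle zero    (true ∷ S) _           ()
∈⇒∉-toggle (suc v) (_ ∷ S)    (there v∈S) (there v∈) = ∈⇒∉-toggle v S v∈S v∈

∉-toggle⇒∈ : ∀ (v : Fin n) S → v ∉ toggle v S → v ∈ S
∉-toggle⇒∈ zero    (true ∷ S)  v∉ = here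
∉-toggle⇒∈ zero    (false ∷ S) v∉ = contradiction here v∉
∉-toggle⇒∈ (suc v) (_ ∷ S)     v∉ = there (∉-toggle⇒∈ v S (v∉ ∘ there))

∣toggle∣ : ∀ (v : Fin n) S → v ∉ toggle v S → ∣ S ∣ ≡ suc ∣ toggle v S ∣
∣toggle∣ zero    (true ∷ S)  _  = refl
∣toggle∣ zero    (false ∷ S) v∉ = contradiction here v∉
∣toggle∣ (suc v) (true ∷ S)  v∉ = cong suc (∣toggle∣ v S (v∉ ∘ there))
∣toggle∣ (suc v) (false ∷ S) v∉ = ∣toggle∣ v S (v∉ ∘ there)

∣p∩q∣+∣p─q∣≡∣p∣ : ∀ (p q : Subset n) → ∣ p ∩ q ∣ + ∣ p ─ q ∣ ≡ ∣ p ∣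
∣p∩q∣+∣p─q∣≡∣p∣ []          []          = refl
∣p∩q∣+∣p─q∣≡∣p∣ (true ∷ p)  (true ∷ q)  = cong suc (∣p∩q∣+∣p─q∣≡∣p∣ p q)
∣p∩q∣+∣p─q∣≡∣p∣ (true ∷ p)  (false ∷ q) = trans (+-suc _ _) (cong suc (∣p∩q∣+∣p─q∣≡∣p∣ p q))
∣p∩q∣+∣p─q∣≡∣p∣ (false ∷ p) (true ∷ q)  = ∣p∩q∣+∣p─q∣≡∣p∣ p q
∣p∩q∣+∣p─q∣≡∣p∣ (false ∷ p) (false ∷ q) = ∣p∩q∣+∣p─q∣≡∣p∣ p q

-- Comparing counts, and counting subsets of a given size.

#-mono : ∀ {P Q : A → Set} (xs : List A) (P? : Decidable P) (Q? : Decidable Q) →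
         (∀ x → P x → Q x) → # xs P? ≤ # xs Q?
#-mono xs P? Q? P⇒Q = ∑-mono xs (λ x → 𝟙-mono (P? x) (Q? x) (P⇒Q x))

#-none : ∀ {P : A → Set} (xs : List A) (P? : Decidable P) → (∀ x → ¬ P x) → # xs P? ≤ 0
#-none xs P? ¬P = ≤-trans (∑-mono xs (λ x → ≤-reflexive (𝟙-no (P? x) (¬P x)))) (≤-reflexive (∑-0 xs))

#-∪ : ∀ {P Q R : A → Set} (xs : List A) (P? : Decidable P) (Q? : Decidable Q) (R? : Decidable R) →
      (∀ x → R x → P x ⊎ Q x) → # xs R? ≤ # xs P? + # xs Q?
#-∪ xs P? Q? R? f = ≤-trans (∑-mono xs (λ x → 𝟙-∪ (P? x) (Q? x) (R? x) (f x))) (≤-reflexive (∑-+ xs _ _))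

#-disjoint : ∀ {P Q R : A → Set} (xs : List A) (P? : Decidable P) (Q? : Decidable Q) (R? : Decidable R) →
             (∀ x → P x → R x) → (∀ x → Q x → R x) → (∀ x → P x → ¬ Q x) → # xs P? + # xs Q? ≤ # xs R?
#-disjoint xs P? Q? R? f g d =
  ≤-trans (≤-reflexive (sym (∑-+ xs _ _)))
          (∑-mono xs (λ x → 𝟙-disjoint (P? x) (Q? x) (R? x) (f x) (g x) (d x)))

infix 4 _⊆[_]?_

_⊆[_]?_ : ∀ (S : Subset n) t A → Dec (S ⊆ A × ∣ S ∣ ≡ t)
S ⊆[ t ]? A = (S ⊆? A) ×-dec (∣ S ∣ ℕ.≟ t)

-- Pascal's rule, according to whether the subset contains the first element.
#-subsets : ∀ n (A : Subset n) t → # (allSubsets n) (_⊆[ t ]? A) ≤ ∣ A ∣ C t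
#-subsets zero    []          zero    = ≤-refl
#-subsets zero    []          (suc t) = z≤n
#-subsets (suc n) (true ∷ A)  zero    = begin
  # (allSubsets (suc n)) (_⊆[ 0 ]? true ∷ A)
    ≡⟨ ∑-allSubsets n _ ⟩
  # (allSubsets n) (λ S → true ∷ S ⊆[ 0 ]? true ∷ A) + # (allSubsets n) (λ S → false ∷ S ⊆[ 0 ]? true ∷ A)
    ≤⟨ +-mono-≤ (#-none (allSubsets n) (λ S → true ∷ S ⊆[ 0 ]? true ∷ A) (λ S ()))
                (#-mono (allSubsets n) (λ S → false ∷ S ⊆[ 0 ]? true ∷ A) (_⊆[ 0 ]? A)
                   (λ S (S⊆A , ∣S∣) → drop-∷-⊆ S⊆A , ∣S∣)) ⟩
  # (allSubsets n) (_⊆[ 0 ]? A)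
    ≤⟨ #-subsets n A 0 ⟩
  ∣ A ∣ C 0
    ∎
  where open ≤-Reasoning
#-subsets (suc n) (true ∷ A)  (suc t) = begin
  # (allSubsets (suc n)) (_⊆[ suc t ]? true ∷ A)
    ≡⟨ ∑-allSubsets n _ ⟩
  # (allSubsets n) (λ S → true ∷ S ⊆[ suc t ]? true ∷ A) + # (allSubsets n) (λ S → false ∷ S ⊆[ suc t ]? true ∷ A)
    ≤⟨ +-mono-≤ (#-mono (allSubsets n) (λ S → true ∷ S ⊆[ suc t ]? true ∷ A) (_⊆[ t ]? A)
                   (λ S (S⊆A , ∣S∣) → drop-∷-⊆ S⊆A , suc-injective ∣S∣))
                (#-mono (allSubsets n) (λ S → false ∷ S ⊆[ suc t ]? true ∷ A) (_⊆[ suc t ]? A)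
                   (λ S (S⊆A , ∣S∣) → drop-∷-⊆ S⊆A , ∣S∣)) ⟩
  # (allSubsets n) (_⊆[ t ]? A) + # (allSubsets n) (_⊆[ suc t ]? A)
    ≤⟨ +-mono-≤ (#-subsets n A t) (#-subsets n A (suc t)) ⟩
  ∣ A ∣ C t + ∣ A ∣ C suc t
    ≡⟨ nCk+nC[k+1]≡[n+1]C[k+1] ∣ A ∣ t ⟩
  suc ∣ A ∣ C suc t
    ∎
  where open ≤-Reasoning
#-subsets (suc n) (false ∷ A) t       = begin
  # (allSubsets (suc n)) (_⊆[ t ]? false ∷ A)
    ≡⟨ ∑-allSubsets n _ ⟩
  # (allSubsets n) (λ S → true ∷ S ⊆[ t ]? false ∷ A) + # (allSubsets n) (λ S → false ∷ S ⊆[ t ]? false ∷ A)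
    ≤⟨ +-mono-≤ (#-none (allSubsets n) (λ S → true ∷ S ⊆[ t ]? false ∷ A) (λ S (S⊆A , _) → case S⊆A here of λ ()))
                (#-mono (allSubsets n) (λ S → false ∷ S ⊆[ t ]? false ∷ A) (_⊆[ t ]? A)
                   (λ S (S⊆A , ∣S∣) → drop-∷-⊆ S⊆A , ∣S∣)) ⟩
  # (allSubsets n) (_⊆[ t ]? A)
    ≤⟨ #-subsets n A t ⟩
  ∣ A ∣ C t
    ∎
  where open ≤-Reasoning

-- Monotonicity and convexity of binomial coefficients.

C-monoˡ-≤ : ∀ t {m n} → m ≤ n → m C t ≤ n C t
C-monoˡ-≤ t {m} m≤n = go (≤⇒≤′ m≤n)
  where
  step : ∀ t n → n C t ≤ suc n C t
  step zero    n = ≤-refl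
  step (suc t) n = ≤-trans (m≤n+m (n C suc t) (n C t)) (≤-reflexive (nCk+nC[k+1]≡[n+1]C[k+1] n t))
  go : ∀ {n} → m ℕ.≤′ n → m C t ≤ n C t
  go ℕ.≤′-refl     = ≤-refl
  go (ℕ.≤′-step p) = ≤-trans (go p) (step t _)

-- Pascal's rule turns one more step of `e` into the extra summands `(e + b) C t` and `(e + c) C t`,
-- which monotonicity compares; the rest is induction on `e`. This is convexity with terms moved
-- across so that no subtraction occurs.
C-convex : ∀ t e {b c} → b ≤ c → (e + b) C t + c C t ≤ (e + c) C t + b C t
C-convex t zero    {b} {c} b≤c = ≤-reflexive (+-comm (b C t) (c C t))
C-convex zero    (suc e) {b} {c} b≤c = ≤-refl
C-convex (suc t) (suc e) {b} {c} b≤c = begin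
  (suc e + b) C suc t + c C suc t
    ≡⟨ cong (_+ c C suc t) (nCk+nC[k+1]≡[n+1]C[k+1] (e + b) t) ⟨
  (e + b) C t + (e + b) C suc t + c C suc t
    ≡⟨ +-assoc ((e + b) C t) _ _ ⟩
  (e + b) C t + ((e + b) C suc t + c C suc t)
    ≤⟨ +-mono-≤ (C-monoˡ-≤ t (+-monoʳ-≤ e b≤c)) (C-convex (suc t) e b≤c) ⟩
  (e + c) C t + ((e + c) C suc t + b C suc t)
    ≡⟨ +-assoc ((e + c) C t) _ _ ⟨
  (e + c) C t + (e + c) C suc t + b C suc t
    ≡⟨ cong (_+ b C suc t) (nCk+nC[k+1]≡[n+1]C[k+1] (e + c) t) ⟩
  (suc e + c) C suc t + b C suc t
    ∎
  where open ≤-Reasoning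

+-swap : ∀ x y z → x + (y + z) ≡ y + (x + z)
+-swap = solve-∀

-- The arithmetic of the induction step: `m` vertices are deleted and `r` remain. If `m ≤ b`, the
-- remainder absorbs the deletion; otherwise one full block of size `D` is broken up. Convexity
-- gives the bound in both cases.
remove-block : ∀ {t D a b m r} → 1 ≤ t → m ≤ D → b < D → m + r ≡ a * D + b →
  ∃ λ a′ → ∃ λ b′ → b′ < D × r ≡ a′ * D + b′ ×
    m C t + (a′ * (D C t) + b′ C t) ≤ a * (D C t) + b C t
remove-block {t} {D} {a} {b} {m} {r} 1≤t m≤D b<D eq with m ≤? b
... | yes m≤b = a , b ∸ m , ≤-<-trans (m∸n≤m b m) b<D , r≡ , bound
  where
  r≡ : r ≡ a * D + (b ∸ m)
  r≡ = +-cancelˡ-≡ m r _ (trans eq (trans (cong (a * D +_) (sym (m+[n∸m]≡n m≤b))) (+-swap (a * D) m (b ∸ m))))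
  open ≤-Reasoning
  bound : m C t + (a * (D C t) + (b ∸ m) C t) ≤ a * (D C t) + b C t
  bound = begin
    m C t + (a * (D C t) + (b ∸ m) C t)
      ≡⟨ +-swap (m C t) (a * (D C t)) _ ⟩
    a * (D C t) + (m C t + (b ∸ m) C t)
      ≡⟨ cong (λ x → a * (D C t) + (x C t + (b ∸ m) C t)) (+-identityʳ m) ⟨
    a * (D C t) + ((m + 0) C t + (b ∸ m) C t)
      -- Convexity from the base point `0` yields superadditivity; the leftover `0 C t` vanishes
      -- because `t ≥ 1`.
      ≤⟨ +-monoʳ-≤ (a * (D C t)) (C-convex t m z≤n) ⟩
    a * (D C t) + ((m + (b ∸ m)) C t + 0 C t)
      ≡⟨ cong (a * (D C t) +_) (trans (cong₂ _+_ (cong (_C t) (m+[n∸m]≡n m≤b)) (k>n⇒nCk≡0 1≤t)) (+-identityʳ (b C t))) ⟩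
    a * (D C t) + b C t
      ∎
-- Without a full block, `m + r` equals `b`, so `m` cannot exceed `b`.
remove-block {a = zero} {m = m} {r} 1≤t m≤D b<D eq | no m≰b =
  contradiction (≤-trans (m≤m+n m r) (≤-reflexive eq)) m≰b
remove-block {t} {D} {suc a} {b} {m} {r} 1≤t m≤D b<D eq | no m≰b =
  a , (D ∸ m) + b , b′<D , r≡ , bound
  where
  b<m = ≰⇒> m≰b
  open ≤-Reasoning
  b′<D : (D ∸ m) + b < D
  b′<D = begin-strict
    (D ∸ m) + b <⟨ +-monoʳ-< (D ∸ m) b<m ⟩
    (D ∸ m) + m ≡⟨ m∸n+n≡m m≤D ⟩
    D           ∎
  r≡ : r ≡ a * D + ((D ∸ m) + b)
  r≡ = +-cancelˡ-≡ m r _ (begin-equality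
    m + r                       ≡⟨ eq ⟩
    D + a * D + b               ≡⟨ cong (λ x → x + a * D + b) (m+[n∸m]≡n m≤D) ⟨
    m + (D ∸ m) + a * D + b     ≡⟨ arrange m (D ∸ m) (a * D) b ⟩
    m + (a * D + ((D ∸ m) + b)) ∎)
    where
    arrange : ∀ x y z w → x + y + z + w ≡ x + (z + (y + w))
    arrange = solve-∀
  e+b≡m : (m ∸ b) + b ≡ m
  e+b≡m = m∸n+n≡m (<⇒≤ b<m)
  e+b′≡D : (m ∸ b) + ((D ∸ m) + b) ≡ D
  e+b′≡D = begin-equality
    (m ∸ b) + ((D ∸ m) + b) ≡⟨ arrange (m ∸ b) (D ∸ m) b ⟩
    (m ∸ b) + b + (D ∸ m)   ≡⟨ cong (_+ (D ∸ m)) e+b≡m ⟩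
    m + (D ∸ m)             ≡⟨ m+[n∸m]≡n m≤D ⟩
    D                       ∎
    where
    arrange : ∀ x y z → x + (y + z) ≡ x + z + y
    arrange = solve-∀
  -- The increment `m ∸ b` carries `b` to `m` and the new remainder `(D ∸ m) + b` to `D`.
  convex : m C t + ((D ∸ m) + b) C t ≤ D C t + b C t
  convex = begin
    m C t + ((D ∸ m) + b) C t               ≡⟨ cong (λ x → x C t + ((D ∸ m) + b) C t) e+b≡m ⟨
    ((m ∸ b) + b) C t + ((D ∸ m) + b) C t   ≤⟨ C-convex t (m ∸ b) (m≤n+m b (D ∸ m)) ⟩
    ((m ∸ b) + ((D ∸ m) + b)) C t + b C t   ≡⟨ cong (λ x → x C t + b C t) e+b′≡D ⟩
    D C t + b C t                           ∎
  bound : m C t + (a * (D C t) + ((D ∸ m) + b) C t) ≤ suc a * (D C t) + b C t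
  bound = begin
    m C t + (a * (D C t) + ((D ∸ m) + b) C t) ≡⟨ +-swap (m C t) (a * (D C t)) _ ⟩
    a * (D C t) + (m C t + ((D ∸ m) + b) C t) ≤⟨ +-monoʳ-≤ (a * (D C t)) convex ⟩
    a * (D C t) + (D C t + b C t)             ≡⟨ arrange (a * (D C t)) (D C t) (b C t) ⟩
    suc a * (D C t) + b C t                   ∎
    where
    arrange : ∀ x y z → x + (y + z) ≡ y + x + z
    arrange = solve-∀

-- Cliques and domination for a reflexive symmetric relation.

module Cliques {n : ℕ} (_~_ : Fin n → Fin n → Set) (_~?_ : ∀ i j → Dec (i ~ j))
               (~-refl : ∀ i → i ~ i) (~-sym : ∀ {i j} → i ~ j → j ~ i) where

  Clique : Subset n → Set
  Clique S = ∀ i → i ∈ S → ∀ j → j ∈ S → i ~ j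

  Dominates : Fin n → Subset n → Set
  Dominates v S = ∀ w → w ∈ S → v ~ w

  Meets : Fin n → Subset n → Set
  Meets v S = ∃ λ w → w ∈ S × v ~ w

  clique? : ∀ S → Dec (Clique S)
  clique? S = all? λ i → (i ∈? S) →-dec all? λ j → (j ∈? S) →-dec (i ~? j)

  dominates? : ∀ v S → Dec (Dominates v S)
  dominates? v S = all? λ w → (w ∈? S) →-dec (v ~? w)

  meets? : ∀ v S → Dec (Meets v S)
  meets? v S = any? λ w → (w ∈? S) ×-dec (v ~? w)

  ball : Fin n → Subset n
  ball v = Vec.tabulate (λ w → does (v ~? w))

  ∈-ball⁺ : ∀ {v w} → v ~ w → w ∈ ball v
  ∈-ball⁺ {v} {w} v~w = lookup⇒[]= w _ (trans (lookup∘tabulate _ w) (dec-true (v ~? w) v~w))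

  ∈-ball⁻ : ∀ {v w} → w ∈ ball v → v ~ w
  ∈-ball⁻ {v} {w} w∈ with v ~? w in eq
  ... | yes v~w = v~w
  ... | no _    = case trans (sym ([]=⇒lookup w∈)) (trans (lookup∘tabulate _ w) (cong does eq)) of λ ()

  -- With `H = S ∪ {v}` and `v ∉ S`, this expresses that `S` is a clique meeting the ball of `v`, in
  -- terms of `H` alone.
  AlmostClique : Subset n → Fin n → Set
  AlmostClique H v = v ∈ H × (∀ i → i ∈ H → i ≢ v → ∀ j → j ∈ H → j ≢ v → i ~ j) ×
                     (∃ λ w → w ∈ H × w ≢ v × v ~ w)

  almostClique? : ∀ H → Decidable (AlmostClique H)
  almostClique? H v = (v ∈? H) ×-dec
    (all? λ i → (i ∈? H) →-dec (¬? (i ≟ v) →-dec all? λ j → (j ∈? H) →-dec (¬? (j ≟ v) →-dec (i ~? j)))) ×-dec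
    (any? λ w → (w ∈? H) ×-dec (¬? (w ≟ v) ×-dec (v ~? w)))

  Dominating : Subset n → Fin n → Set
  Dominating H v = v ∈ H × Dominates v H

  dominating? : ∀ H → Decidable (Dominating H)
  dominating? H v = (v ∈? H) ×-dec dominates? v H

  -- Otherwise three singletons would cover `H`.
  fourth-vertex : ∀ {H} x y z → 4 ≤ ∣ H ∣ → ∃ λ w → w ∈ H × w ≢ x × w ≢ y × w ≢ z
  fourth-vertex {H} x y z 4≤∣H∣
    with any? (λ w → (w ∈? H) ×-dec (¬? (w ≟ x) ×-dec (¬? (w ≟ y) ×-dec ¬? (w ≟ z))))
  ... | yes w = w
  ... | no ¬w = contradiction 4≤∣H∣ (<⇒≱ (s≤s (begin
    ∣ H ∣ ≡⟨ ∣∣≡# H ⟩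
    # (allFin n) (_∈? H)
      ≤⟨ #-∪ (allFin n) (_≟ x) (λ w → (w ≟ y) ⊎-dec (w ≟ z)) (_∈? H) cover ⟩
    # (allFin n) (_≟ x) + # (allFin n) (λ w → (w ≟ y) ⊎-dec (w ≟ z))
      ≤⟨ +-monoʳ-≤ (# (allFin n) (_≟ x)) (#-∪ (allFin n) (_≟ y) (_≟ z) (λ w → (w ≟ y) ⊎-dec (w ≟ z)) (λ _ → id)) ⟩
    # (allFin n) (_≟ x) + (# (allFin n) (_≟ y) + # (allFin n) (_≟ z))
      ≡⟨ cong₂ _+_ (#-singleton x) (cong₂ _+_ (#-singleton y) (#-singleton z)) ⟩
    3 ∎)))
    where
    open ≤-Reasoning
    cover : ∀ w → w ∈ H → w ≡ x ⊎ w ≡ y ⊎ w ≡ z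
    cover w w∈H with w ≟ x | w ≟ y | w ≟ z
    ... | yes w≡x | _       | _       = inj₁ w≡x
    ... | no _    | yes w≡y | _       = inj₂ (inj₁ w≡y)
    ... | no _    | no _    | yes w≡z = inj₂ (inj₂ w≡z)
    ... | no w≢x  | no w≢y  | no w≢z  = contradiction (w , w∈H , w≢x , w≢y , w≢z) ¬w

  -- Either every candidate dominates `H`, and inclusion suffices, or some candidate `x` has a
  -- non-neighbour `y` in `H`. In the second case there are at most two candidates, and as many
  -- dominating vertices are exhibited.
  #almostClique≤#dominating : ∀ H → 4 ≤ ∣ H ∣ →
    # (allFin n) (almostClique? H) ≤ # (allFin n) (dominating? H)
  #almostClique≤#dominating H 4≤∣H∣
    with any? (λ x → almostClique? H x ×-dec ¬? (dominating? H x))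
  ... | no ¬x = #-mono (allFin n) (almostClique? H) (dominating? H)
                  (λ x Ax → decidable-stable (dominating? H x) (λ ¬Dx → ¬x (x , Ax , ¬Dx)))
  ... | yes (x , (x∈H , cliqueˣ , u , u∈H , u≢x , x~u) , ¬Dx)
    with any? (λ y → (y ∈? H) ×-dec ¬? (x ~? y))
  ...   | no ¬y = contradiction
                    (x∈H , λ y y∈H → decidable-stable (x ~? y) (λ x≁y → ¬y (y , y∈H , x≁y))) ¬Dx
  ...   | yes (y , y∈H , x≁y) = result
    where
    open ≤-Reasoning
    xs = allFin n

    y≢x : y ≢ x
    y≢x refl = x≁y (~-refl x)

    -- Such a `w` is adjacent to the rest of the clique `H ∖ {x}`, and to `x` by assumption.
    dominating : ∀ {w} → w ∈ H → w ≢ x → x ~ w → Dominating H w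
    dominating {w} w∈H w≢x x~w = w∈H , λ z z∈H → go z z∈H (z ≟ x)
      where
      go : ∀ z → z ∈ H → Dec (z ≡ x) → w ~ z
      go z z∈H (yes refl) = ~-sym x~w
      go z z∈H (no z≢x)   = cliqueˣ w w∈H w≢x z z∈H z≢x

    -- Deleting a vertex other than x and y leaves the non-adjacent pair x, y.
    only-x-y : ∀ z → AlmostClique H z → z ≡ x ⊎ z ≡ y
    only-x-y z (_ , cliqueᶻ , _) with z ≟ x | z ≟ y
    ... | yes z≡x | _       = inj₁ z≡x
    ... | no _    | yes z≡y = inj₂ z≡y
    ... | no z≢x  | no z≢y  = contradiction (cliqueᶻ x x∈H (z≢x ∘ sym) y y∈H (z≢y ∘ sym)) x≁y

    result : # xs (almostClique? H) ≤ # xs (dominating? H)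
    result with almostClique? H y
    -- Here `x` is the only candidate, and its neighbour `u` dominates `H`.
    ... | no ¬Ay = begin
      # xs (almostClique? H) ≤⟨ #-mono xs (almostClique? H) (_≟ x) only-x ⟩
      # xs (_≟ x)            ≡⟨ trans (#-singleton x) (sym (#-singleton u)) ⟩
      # xs (_≟ u)            ≤⟨ #-mono xs (_≟ u) (dominating? H) (λ { _ refl → dominating u∈H u≢x x~u }) ⟩
      # xs (dominating? H)   ∎
      where
      only-x : ∀ z → AlmostClique H z → z ≡ x
      only-x z Az with only-x-y z Az
      ... | inj₁ z≡x  = z≡x
      ... | inj₂ refl = contradiction Az ¬Ay
    -- Now `H ∖ {y}` is a clique too, so `x` is adjacent to everything in `H` except `y`. As `H` has
    -- at least four vertices, a vertex `w` besides `x`, `y`, `u` exists, and both `u` and `w`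
    -- dominate `H`.
    ... | yes (_ , cliqueʸ , _) with fourth-vertex x y u 4≤∣H∣
    ...   | w , w∈H , w≢x , w≢y , w≢u = begin
      # xs (almostClique? H)      ≤⟨ #-∪ xs (_≟ x) (_≟ y) (almostClique? H) only-x-y ⟩
      # xs (_≟ x) + # xs (_≟ y)   ≡⟨ cong₂ _+_ (#-singleton x) (#-singleton y) ⟩
      2                           ≡⟨ cong₂ _+_ (#-singleton u) (#-singleton w) ⟨
      # xs (_≟ u) + # xs (_≟ w)
        ≤⟨ #-disjoint xs (_≟ u) (_≟ w) (dominating? H)
             (λ { _ refl → dominating u∈H u≢x x~u })
             (λ { _ refl → dominating w∈H w≢x (cliqueʸ x x∈H (y≢x ∘ sym) w w∈H w≢y) })
             (λ { _ refl refl → w≢u refl }) ⟩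
      # xs (dominating? H)        ∎

  -- Double counting pairs of a vertex and a `t`-set.

  module _ (U : Subset n) (t : ℕ) where

    CliqueIn : Subset n → Set
    CliqueIn S = (S ⊆ U × ∣ S ∣ ≡ t) × Clique S

    cliqueIn? : Decidable CliqueIn
    cliqueIn? S = (S ⊆[ t ]? U) ×-dec clique? S

    -- Building `v ∈ U` into this predicate and into `Star` lets sums run over all vertices, those
    -- outside `U` contributing zero.
    Near : Fin n → Subset n → Set
    Near v S = CliqueIn S × v ∈ U × Meets v S

    near? : ∀ v → Decidable (Near v)
    near? v S = cliqueIn? S ×-dec ((v ∈? U) ×-dec meets? v S)

    Star : Fin n → Subset n → Set
    Star v S = (S ⊆ U × ∣ S ∣ ≡ t) × v ∈ U × Dominates v S

    star? : ∀ v → Decidable (Star v)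
    star? v S = (S ⊆[ t ]? U) ×-dec ((v ∈? U) ×-dec dominates? v S)

  #cliques : Subset n → ℕ → ℕ
  #cliques U t = # (allSubsets n) (cliqueIn? U t)

  #near #star : Subset n → ℕ → Fin n → ℕ
  #near U t v = # (allSubsets n) (near? U t v)
  #star U t v = # (allSubsets n) (star? U t v)

  module _ (U : Subset n) {t : ℕ} (3≤t : 3 ≤ t) where

    near∋ : ∀ v S → Dec (Near U t v S × v ∈ S)
    near∋ v S = near? U t v S ×-dec (v ∈? S)

    star∋ : ∀ v S → Dec (Star U t v S × v ∈ S)
    star∋ v S = star? U t v S ×-dec (v ∈? S)

    near∌ : ∀ v S → Dec (Near U t v S × v ∉ S)
    near∌ v S = near? U t v S ×-dec ¬? (v ∈? S)

    star∌ : ∀ v S → Dec (Star U t v S × v ∉ S)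
    star∌ v S = star? U t v S ×-dec ¬? (v ∈? S)

    -- With H = toggle v S = S ∪ {v}, the pairs (v , S) with v ∉ S are compared H by H.
    near∌≤star∌-at : ∀ H → # (allFin n) (λ v → near∌ v (toggle v H)) ≤ # (allFin n) (λ v → star∌ v (toggle v H))
    near∌≤star∌-at H with any? (λ v → near∌ v (toggle v H))
    ... | no ¬v = ≤-trans (#-none (allFin n) (λ v → near∌ v (toggle v H)) (λ v p → ¬v (v , p))) z≤n
    -- A single near pair already fixes `∣ H ∣ = t + 1` and `H ⊆ U`; these make every dominating
    -- vertex of `H` yield a star pair.
    ... | yes (v₀ , (((S⊆U , ∣S∣≡t) , _) , v₀∈U , _) , v₀∉) = begin
      # (allFin n) (λ v → near∌ v (toggle v H)) ≤⟨ #-mono (allFin n) (λ v → near∌ v (toggle v H)) (almostClique? H) near⇒almost ⟩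
      # (allFin n) (almostClique? H)            ≤⟨ #almostClique≤#dominating H 4≤∣H∣ ⟩
      # (allFin n) (dominating? H)              ≤⟨ #-mono (allFin n) (dominating? H) (λ v → star∌ v (toggle v H)) dominating⇒star ⟩
      # (allFin n) (λ v → star∌ v (toggle v H)) ∎
      where
      open ≤-Reasoning

      ∣H∣≡1+t : ∣ H ∣ ≡ suc t
      ∣H∣≡1+t = trans (∣toggle∣ v₀ H v₀∉) (cong suc ∣S∣≡t)

      4≤∣H∣ : 4 ≤ ∣ H ∣
      4≤∣H∣ = subst (4 ≤_) (sym ∣H∣≡1+t) (s≤s 3≤t)

      H⊆U : H ⊆ U
      H⊆U {w} w∈H with w ≟ v₀
      ... | yes refl = v₀∈U
      ... | no w≢v₀  = S⊆U (∈-toggle⁺ w≢v₀ w∈H)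

      near⇒almost : ∀ v → Near U t v (toggle v H) × v ∉ toggle v H → AlmostClique H v
      near⇒almost v ((((_ , _) , clique) , _ , w , w∈ , v~w) , v∉) =
        ∉-toggle⇒∈ v H v∉ ,
        (λ i i∈H i≢v j j∈H j≢v → clique i (∈-toggle⁺ i≢v i∈H) j (∈-toggle⁺ j≢v j∈H)) ,
        w , ∈-toggle⁻ w≢v w∈ , w≢v , v~w
        where
        w≢v : w ≢ v
        w≢v refl = v∉ w∈

      dominating⇒star : ∀ v → Dominating H v → Star U t v (toggle v H) × v ∉ toggle v H
      dominating⇒star v (v∈H , dom) =
        (((λ w∈ → H⊆U (back w∈)) , suc-injective (trans (sym (∣toggle∣ v H v∉)) ∣H∣≡1+t)) ,
         H⊆U v∈H , λ w w∈ → dom w (back w∈)) , v∉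
        where
        v∉ : v ∉ toggle v H
        v∉ = ∈⇒∉-toggle v H v∈H
        back : ∀ {w} → w ∈ toggle v H → w ∈ H
        back w∈ = ∈-toggle⁻ (λ { refl → v∉ w∈ }) w∈

    -- Pairs are split by whether `v ∈ S`. A clique through `v` is dominated by `v`; the other pairs
    -- are regrouped by `S ∪ {v}`.
    #near≤#star : ∑ (allFin n) (#near U t) ≤ ∑ (allFin n) (#star U t)
    #near≤#star = begin
      ∑ V (#near U t)
        ≤⟨ ∑-mono V (λ v → #-∪ 𝒫 (near∋ v) (near∌ v) (near? U t v) (split v)) ⟩
      ∑ V (λ v → # 𝒫 (near∋ v) + # 𝒫 (near∌ v))
        ≡⟨ ∑-+ V _ _ ⟩
      ∑ V (λ v → # 𝒫 (near∋ v)) + ∑ V (λ v → # 𝒫 (near∌ v))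
        ≤⟨ +-mono-≤ (∑-mono V (λ v → #-mono 𝒫 (near∋ v) (star∋ v) (near∋⇒star∋ v))) outside ⟩
      ∑ V (λ v → # 𝒫 (star∋ v)) + ∑ V (λ v → # 𝒫 (star∌ v))
        ≡⟨ ∑-+ V _ _ ⟨
      ∑ V (λ v → # 𝒫 (star∋ v) + # 𝒫 (star∌ v))
        ≤⟨ ∑-mono V (λ v → #-disjoint 𝒫 (star∋ v) (star∌ v) (star? U t v)
             (λ _ → proj₁) (λ _ → proj₁) (λ _ (_ , v∈S) (_ , v∉S) → v∉S v∈S)) ⟩
      ∑ V (#star U t)
        ∎
      where
      open ≤-Reasoning
      V = allFin n
      𝒫 = allSubsets n

      split : ∀ v S → Near U t v S → (Near U t v S × v ∈ S) ⊎ (Near U t v S × v ∉ S)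
      split v S p with v ∈? S
      ... | yes v∈S = inj₁ (p , v∈S)
      ... | no v∉S  = inj₂ (p , v∉S)

      near∋⇒star∋ : ∀ v S → Near U t v S × v ∈ S → Star U t v S × v ∈ S
      near∋⇒star∋ v S (((S⊆U,∣S∣≡t , clique) , v∈U , _) , v∈S) = (S⊆U,∣S∣≡t , v∈U , clique v v∈S) , v∈S

      outside : ∑ V (λ v → # 𝒫 (near∌ v)) ≤ ∑ V (λ v → # 𝒫 (star∌ v))
      outside = begin
        ∑ V (λ v → # 𝒫 (near∌ v))                   ≡⟨ ∑-by-toggle (λ v S → 𝟙 (near∌ v S)) ⟩
        ∑ 𝒫 (λ H → # V (λ v → near∌ v (toggle v H))) ≤⟨ ∑-mono 𝒫 near∌≤star∌-at ⟩
        ∑ 𝒫 (λ H → # V (λ v → star∌ v (toggle v H))) ≡⟨ ∑-by-toggle (λ v S → 𝟙 (star∌ v S)) ⟨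
        ∑ V (λ v → # 𝒫 (star∌ v))                   ∎

    -- If every vertex of `U` failed, the star sum would be strictly smaller: strict at `u`, and
    -- weakly so outside `U`, where `#star` is zero.
    good-vertex : Nonempty U → ∃ λ v → v ∈ U × #near U t v ≤ #star U t v
    good-vertex (u , u∈U) with any? (λ v → (v ∈? U) ×-dec (#near U t v ≤? #star U t v))
    ... | yes v = v
    ... | no ¬v = contradiction #near≤#star (<⇒≱ (∑-strict star≤near (∈-allFin u) (≰⇒> λ le → ¬v (u , u∈U , le))))
      where
      star≤near : ∀ v → #star U t v ≤ #near U t v
      star≤near v = decide (v ∈? U)
        where
        decide : Dec (v ∈ U) → #star U t v ≤ #near U t v
        decide (yes v∈U) = <⇒≤ (≰⇒> λ le → ¬v (v , v∈U , le))
        decide (no v∉U)  = ≤-trans (#-none (allSubsets n) (star? U t v) (λ _ (_ , v∈U , _) → v∉U v∈U)) z≤n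

    -- Deleting a ball and induction on the vertex set.

    #star≤C : ∀ v → #star U t v ≤ ∣ U ∩ ball v ∣ C t
    #star≤C v = ≤-trans
      (#-mono (allSubsets n) (star? U t v) (_⊆[ t ]? U ∩ ball v)
        (λ S ((S⊆U , ∣S∣≡t) , _ , dom) → (λ {w} w∈S → x∈p∩q⁺ (S⊆U w∈S , ∈-ball⁺ (dom w w∈S))) , ∣S∣≡t))
      (#-subsets n (U ∩ ball v) t)

    -- A clique that does not meet the ball of `v` survives its deletion.
    #cliques≤#near+rest : ∀ {v} → v ∈ U → #cliques U t ≤ #near U t v + #cliques (U ─ ball v) t
    #cliques≤#near+rest {v} v∈U =
      #-∪ (allSubsets n) (near? U t v) (cliqueIn? (U ─ ball v) t) (cliqueIn? U t) split
      where
      split : ∀ S → CliqueIn U t S → Near U t v S ⊎ CliqueIn (U ─ ball v) t S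
      split S p@((S⊆U , ∣S∣≡t) , clique) with meets? v S
      ... | yes meets = inj₁ (p , v∈U , meets)
      ... | no ¬meets = inj₂ (((λ {w} w∈S →
              x∈p∧x∉q⇒x∈p─q (S⊆U w∈S) (λ w∈ball → ¬meets (w , w∈S , ∈-ball⁻ w∈ball))) , ∣S∣≡t) , clique)

  #cliques-bound : ∀ {t D} → 3 ≤ t → (∀ v → ∣ ball v ∣ ≤ D) →
    ∀ {N} U a b → ∣ U ∣ ≡ N → N ≡ a * D + b → b < D → #cliques U t ≤ a * (D C t) + b C t
  #cliques-bound {t} {D} 3≤t ∣ball∣≤D {N} = <-rec Bound step N
    where
    open ≤-Reasoning
    Bound : ℕ → Set
    Bound N = ∀ U a b → ∣ U ∣ ≡ N → N ≡ a * D + b → b < D → #cliques U t ≤ a * (D C t) + b C t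

    step : ∀ N → (∀ {M} → M < N → Bound M) → Bound N
    step N rec U a b refl eq b<D with nonempty? U
    -- The empty set has no subset of size `t ≥ 3`.
    ... | no empty = ≤-trans (#-none (allSubsets n) (cliqueIn? U t) none) z≤n
      where
      none : ∀ S → ¬ CliqueIn U t S
      none S ((S⊆U , refl) , _) with Empty-unique empty
      ... | refl = contradiction (≤-trans 3≤t (p⊆q⇒∣p∣≤∣q∣ S⊆U)) (<⇒≱ (subst (_< 3) (sym (∣⊥∣≡0 n)) (s≤s z≤n)))
    ... | yes nonempty with good-vertex U 3≤t nonempty
    ...   | v , v∈U , near≤star
      with remove-block {a = a} (≤-trans (s≤s z≤n) 3≤t) (≤-trans (∣p∩q∣≤∣q∣ U (ball v)) (∣ball∣≤D v)) b<D
             (trans (∣p∩q∣+∣p─q∣≡∣p∣ U (ball v)) eq)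
    ...     | a′ , b′ , b′<D , rest≡ , bound = begin
      #cliques U t                                          ≤⟨ #cliques≤#near+rest U 3≤t v∈U ⟩
      #near U t v + #cliques (U ─ ball v) t                 ≤⟨ +-mono-≤ (≤-trans near≤star (#star≤C U 3≤t v)) rest ⟩
      ∣ U ∩ ball v ∣ C t + (a′ * (D C t) + b′ C t)          ≤⟨ bound ⟩
      a * (D C t) + b C t                                   ∎
      where
      -- The ball of `v` contains `v ∈ U`, so its deletion strictly shrinks `U`.
      rest = rec (p∩q≢∅⇒∣p─q∣<∣p∣ U (ball v) (v , x∈p∩q⁺ (v∈U , ∈-ball⁺ (~-refl v))))
                 (U ─ ball v) a′ b′ refl rest≡ b′<D

-- From the Boolean definitions to the abstract bound.

foldr-∑ : ∀ {m} (f : Fin n → ℕ) (g : Fin m → Fin n) →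
  Vec.foldr (λ _ → ℕ) (λ i acc → f i + acc) 0 (Vec.tabulate g) ≡ ∑ (tabulate g) f
foldr-∑ {m = zero}  f g = refl
foldr-∑ {m = suc m} f g = cong (f (g zero) +_) (foldr-∑ f (g ∘ suc))

-- A general `g` is needed for the induction: the tail of a tabulation of `g` tabulates `g ∘ suc`.
foldr-∧ : ∀ {m} (p : Fin n → Bool) (g : Fin m → Fin n) →
  T (Vec.foldr (λ _ → Bool) (λ i acc → p i ∧ acc) true (Vec.tabulate g)) → ∀ i → T (p (g i))
foldr-∧ p g t zero    = proj₁ (Equivalence.to T-∧ t)
foldr-∧ p g t (suc i) = foldr-∧ p (g ∘ suc) (proj₂ (Equivalence.to (T-∧ {p (g zero)}) t)) i

allPairs-sound : ∀ (p : Fin n → Fin n → Bool) → T (allPairs p) → ∀ i j → T (p i j)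
allPairs-sound p t i j = foldr-∧ (p i) id (foldr-∧ _ id t i) j

length-filterᵇ≤# : ∀ {P : A → Set} (p : A → Bool) (P? : Decidable P) → (∀ x → T (p x) → P x) →
  ∀ xs → length (filterᵇ p xs) ≤ # xs P?
length-filterᵇ≤# p P? sound []       = z≤n
length-filterᵇ≤# p P? sound (x ∷ xs) with p x | sound x | P? x
... | true  | s | yes _ = s≤s (length-filterᵇ≤# p P? sound xs)
... | true  | s | no ¬p = contradiction (s _) ¬p
... | false | s | d     = ≤-trans (length-filterᵇ≤# p P? sound xs) (m≤n+m _ (𝟙 d))

module _ {n : ℕ} (G : SimpleGraph n) where

  -- Adjacency made reflexive, so that its balls are the closed neighbourhoods N[v].
  _~_ : Fin n → Fin n → Set
  i ~ j = i ≡ j ⊎ T (adj G i j)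

  _~?_ : ∀ i j → Dec (i ~ j)
  i ~? j = (i ≟ j) ⊎-dec T? (adj G i j)

  ~-sym : ∀ {i j} → i ~ j → j ~ i
  ~-sym (inj₁ i≡j) = inj₁ (sym i≡j)
  ~-sym {i} {j} (inj₂ e) = inj₂ (subst T (symmetric G i j) e)

  open Cliques _~_ _~?_ (λ _ → inj₁ refl) ~-sym

  -- The closed neighbourhood is covered by `v` itself, which accounts for the one, and its
  -- neighbours.
  ∣ball∣≤1+degree : ∀ v → ∣ ball v ∣ ≤ suc (degree G v)
  ∣ball∣≤1+degree v = begin
    ∣ ball v ∣                                               ≡⟨ ∣∣≡# (ball v) ⟩
    # (allFin n) (_∈? ball v)                                ≤⟨ #-∪ (allFin n) (_≟ v) (λ w → T? (adj G v w)) (_∈? ball v) split ⟩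
    # (allFin n) (_≟ v) + # (allFin n) (λ w → T? (adj G v w)) ≡⟨ cong₂ _+_ (#-singleton v) (sym (foldr-∑ (λ w → 𝟙 (T? (adj G v w))) id)) ⟩
    suc (degree G v)                                         ∎
    where
    open ≤-Reasoning
    split : ∀ w → w ∈ ball v → w ≡ v ⊎ T (adj G v w)
    split w w∈ with ∈-ball⁻ w∈
    ... | inj₁ v≡w = inj₁ (sym v≡w)
    ... | inj₂ e   = inj₂ e

  isClique-sound : ∀ S → T (isClique G S) → Clique S
  isClique-sound S t i i∈S j j∈S with allPairs-sound _ t i j
  -- Membership of both endpoints reduces the Boolean implication in the test to its conclusion,
  -- equality or adjacency.
  ... | pair rewrite []=⇒lookup i∈S | []=⇒lookup j∈S with i ≟ j
  ...   | yes i≡j = inj₁ i≡j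
  ...   | no _    = inj₂ pair

  k≤#cliques : ∀ t → k t G ≤ #cliques ⊤ t
  k≤#cliques t = length-filterᵇ≤# _ (cliqueIn? ⊤ t) sound (allSubsets n)
    where
    sound : ∀ S → T ((∣ S ∣ ≡ᵇ t) ∧ isClique G S) → CliqueIn ⊤ t S
    sound S p with Equivalence.to T-∧ p
    ... | size , clique = ((λ _ → ∈⊤) , ≡ᵇ⇒≡ _ t size) , isClique-sound S clique

  k-bound : ∀ {t Δ a b} → 3 ≤ t → (∀ v → degree G v ≤ Δ) → n ≡ a * suc Δ + b → b ≤ Δ →
            k t G ≤ a * (suc Δ C t) + b C t
  k-bound {t} {Δ} {a} {b} 3≤t degree≤Δ n≡ b≤Δ = ≤-trans (k≤#cliques t)
    -- The whole vertex set is taken for `U` and `suc Δ` for the block size, so `b ≤ Δ` becomes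
    -- `b < suc Δ`.
    (#cliques-bound 3≤t (λ v → ≤-trans (∣ball∣≤1+degree v) (s≤s (degree≤Δ v)))
      ⊤ a b (∣⊤∣≡n n) n≡ (s≤s b≤Δ))

theorem1 : (t Δ n a b : ℕ) → 3 ≤ t → 1 ≤ Δ → (G : SimpleGraph n)
    → (∀ v → degree G v ≤ Δ)
    → n ≡ a * suc Δ + b → b ≤ Δ
    → k t G ≤ a * (suc Δ C t) + b C t
theorem1 t Δ n a b 3≤t _ G = k-bound G {a = a} 3≤t
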